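{- Let $1<\kappa_1<\kappa_2$ be integers. Then there is a constant $c_{\kappa_1,\kappa_2}>0$, depending only on $\kappa_1,\kappa_2$, such that for all sufficiently large $x$ there exist sets of positive integers $A,B,C\subseteq\{1,2,\dots,x\}$ with $$|A|=\kappa_1,\quad |B|=\kappa_2,\quad |C|\geq |B|\geq |A|,$$ such that every element of $A+B+C$ is prime and $$|A+B+C|\ >\ c_{\kappa_1,\kappa_2}\,\frac{x}{\log^{\kappa_1\kappa_2}x}.$$
   Context: For sets $A,B,C$ of integers, $A+B+C=\{a+b+c: a\in A,b\in B,c\in C\}$ and $|S|$ denotes the number of elements of a finite set $S$. -}

module Defs where

open import Data.Nat using (ℕ; _+_; _≤_; _≟_)
open import Data.List using (List; cartesianProductWith; deduplicate; length)
open import Data.List.Relation.Unary.All using (All)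
open import Data.List.Relation.Unary.Unique.Propositional using (Unique)
open import Data.Product using (_×_)

-- A finite set of integers is represented by a duplicate-free list.
-- The sumset A + B + C as a list (possibly with repetitions).
sumset3 : List ℕ → List ℕ → List ℕ → List ℕ
sumset3 A B C = cartesianProductWith _+_ (cartesianProductWith _+_ A B) C

sumset3Set : List ℕ → List ℕ → List ℕ → List ℕ
sumset3Set A B C = deduplicate _≟_ (sumset3 A B C)

SubsetUpTo : ℕ → List ℕ → Set
SubsetUpTo x S = Unique S × All (λ a → 1 ≤ a × a ≤ x) S

{-# OPTIONS --safe #-}
module Submission where

-- Averaging over shifts: if all elements of a set S of integers lie above those of a set T, then
-- each t ∈ T reaches each s ∈ S by the positive shift s − t, so some shift b ≤ max S satisfies
-- |T ∩ (S − b)| ≥ |T| |S| / max S, and half of that is still available after forbidding a bounded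
-- number of shifts.  Iterating k times from an interval, a set of density σ contains C + B with
-- |B| = k and C of density ≫ σ ^ k.  Applied to the primes in (n, 32 n], which have density
-- ≫ 1 / log n, this gives T + A with |A| = κ₁ and T ⊆ (n / 2, n]; applied again to T it gives
-- T ⊇ C + B, with C of density ≫ (log n) ^ (− κ₁ κ₂).
--
-- The density of the primes in (n, 32 n] needs both Chebyshev bounds.  The lower one follows from
-- 2 ^ m ≤ (2m choose m) ≤ lcm (1, …, 2m) ≤ (2m) ^ π(2m) (Nair), the upper one from the fact that
-- the product of the primes in (m, 2m] divides (2m choose m) ≤ 4 ^ m.

open import Defs
open import Data.Nat using (ℕ; zero; suc; _+_; _*_; _∸_; _^_; _!; _≤_; _<_; _≥_; z≤n; s≤s; _≟_; _≤?_; ⌊_/2⌋; ⌈_/2⌉; NonZero; >-nonZero; >-nonZero⁻¹; nonTrivial⇒n>1)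
open import Data.Nat.Properties
open import Algebra.Properties.CommutativeSemigroup +-commutativeSemigroup using (x∙yz≈y∙xz)
open import Data.Nat.DivMod using (_/_; _%_; m≡m%n+[m/n]*n; m%n<n; /-monoˡ-≤; m*n/n≡m)
open import Data.Nat.Divisibility
open import Data.Nat.Induction using (<-rec)
open import Data.Nat.ListAction using (sum; product)
open import Data.Nat.ListAction.Properties using (∈⇒∣product; product≢0)
open import Data.Nat.Logarithm using (⌊log₂_⌋; ⌊log₂⌋-mono-≤; ⌊log₂⌊n/2⌋⌋≡⌊log₂n⌋∸1; ⌊log₂[2^n]⌋≡n)
open import Data.Nat.Primality using (Prime; prime?; euclidsLemma; prime⇒nonZero; prime⇒nonTrivial; prime⇒irreducible; ¬prime[0]; ¬prime[1])
open import Data.Nat.Primality.Factorisation using (PrimeFactorisation; factorise; factorisationHasAllPrimeFactors)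
open import Data.Nat.Tactic.RingSolver using (solve-∀)
open import Data.List using (List; []; _∷_; _++_; length; map; filter; applyUpTo; cartesianProductWith)
open import Data.List.Properties using (length-map; length-++; length-filter; filter-notAll; length-applyUpTo)
open import Data.List.Membership.Propositional using (_∈_; _∉_)
open import Data.List.Membership.Propositional.Properties
open import Data.List.Membership.DecPropositional _≟_ using (_∈?_; _∉?_)
open import Data.List.Relation.Unary.All as All using (All; []; _∷_)
open import Data.List.Relation.Unary.All.Properties as All using ()
open import Data.List.Relation.Unary.Any as Any using (here; there)
open import Data.List.Relation.Unary.AllPairs using ([]; _∷_)
open import Data.List.Relation.Unary.Unique.Propositional using (Unique)
import Data.List.Relation.Unary.Unique.Propositional.Properties as Unique
open import Data.Product using (_×_; _,_; proj₁; proj₂; ∃-syntax)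
open import Data.Sum using (inj₁; inj₂)
open import Function using (_∘_)
open import Relation.Nullary using (¬_; yes; no; contradiction)
open import Relation.Nullary.Decidable using (¬?)
open import Relation.Binary.PropositionalEquality using (_≡_; refl; sym; trans; cong; cong₂; subst; subst₂; module ≡-Reasoning)

-- Counting shifts

-- Induction on `xs`: deleting the head from `ys` makes it strictly shorter and, by uniqueness,
-- keeps all remaining elements of `xs`.
Unique⇒length≤ : ∀ {xs ys : List ℕ} → Unique xs → (∀ {z} → z ∈ xs → z ∈ ys) → length xs ≤ length ys
Unique⇒length≤ [] _ = z≤n
Unique⇒length≤ {x ∷ xs} {ys} (x∉xs ∷ xs!) sub = ≤-<-trans
  (Unique⇒length≤ xs! λ z∈xs → ∈-filter⁺ x≢? (sub (there z∈xs)) (All.lookup x∉xs z∈xs))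
  (filter-notAll x≢? ys (Any.map (λ x≡y x≢y → x≢y x≡y) (sub (here refl))))
  where x≢? = λ y → ¬? (x ≟ y)

interval : ℕ → ℕ → List ℕ
interval a n = applyUpTo (λ i → suc (a + i)) n

∈-interval⁺ : ∀ {a n x} → a < x → x ≤ a + n → x ∈ interval a n
∈-interval⁺ {a} {n} {suc x} (s≤s a≤x) x<a+n =
  subst (_∈ interval a n) (cong suc (m+[n∸m]≡n a≤x))
    (∈-applyUpTo⁺ _ (+-cancelˡ-< a _ _ (subst (_< a + n) (sym (m+[n∸m]≡n a≤x)) x<a+n)))

∈-interval⁻ : ∀ {a n x} → x ∈ interval a n → a < x × x ≤ a + n
∈-interval⁻ {a} x∈ with i , i<n , refl ← ∈-applyUpTo⁻ _ x∈ = s≤s (m≤m+n a i) , +-monoʳ-< a i<n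

interval! : ∀ a n → Unique (interval a n)
interval! a n = Unique.applyUpTo⁺₁ _ n λ i<j _ eq → <⇒≢ i<j (+-cancelˡ-≡ (suc a) _ _ eq)

-- Pigeonhole: the `y` found is a maximiser of `f`.
average≤value : ∀ (f : ℕ → ℕ) x xs → ∃[ y ] (y ∈ x ∷ xs × sum (map f (x ∷ xs)) ≤ length (x ∷ xs) * f y)
average≤value f x [] = x , here refl , ≤-refl
average≤value f x (x′ ∷ xs) with average≤value f x′ xs
... | y , y∈ , le with ≤-total (f x) (f y)
...   | inj₁ fx≤fy = y , there y∈ , +-mono-≤ fx≤fy le
...   | inj₂ fy≤fx = x , here refl , +-monoʳ-≤ (f x) (≤-trans le (*-monoʳ-≤ (suc (length xs)) fy≤fx))

sum-≥ : ∀ (f : ℕ → ℕ) c xs → (∀ {x} → x ∈ xs → c ≤ f x) → length xs * c ≤ sum (map f xs)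
sum-≥ f c [] _ = z≤n
sum-≥ f c (x ∷ xs) c≤ = +-mono-≤ (c≤ (here refl)) (sum-≥ f c xs (c≤ ∘ there))

module _ (S : List ℕ) where

  hits : List ℕ → ℕ → List ℕ
  hits T b = filter (λ t → t + b ∈? S) T

  jumps : List ℕ → ℕ → List ℕ
  jumps R t = filter (λ b → t + b ∈? S) R

  jumps-[] : ∀ T → sum (map (λ t → length (jumps [] t)) T) ≡ 0
  jumps-[] [] = refl
  jumps-[] (_ ∷ T) = jumps-[] T

  jumps-∷ : ∀ b R T → sum (map (λ t → length (jumps (b ∷ R) t)) T)
                    ≡ length (hits T b) + sum (map (λ t → length (jumps R t)) T)
  jumps-∷ b R [] = refl
  jumps-∷ b R (t ∷ T) with t + b ∈? S | trans (cong (length (jumps R t) +_) (jumps-∷ b R T))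
                                               (x∙yz≈y∙xz (length (jumps R t)) (length (hits T b)) _)
  ... | yes _ | eq = cong suc eq
  ... | no _  | eq = eq

  -- Both sides count the pairs (t, b) in `T` × `R` with `t + b ∈ S`.
  double-count : ∀ R T → sum (map (λ t → length (jumps R t)) T) ≡ sum (map (λ b → length (hits T b)) R)
  double-count [] T = jumps-[] T
  double-count (b ∷ R) T = trans (jumps-∷ b R T) (cong (length (hits T b) +_) (double-count R T))

  module _ {M : ℕ} (S! : Unique S) (S≤M : ∀ {s} → s ∈ S → s ≤ M) where

    avoiding : List ℕ → List ℕ
    avoiding B = filter (_∉? B) (interval 0 M)

    -- Every s ∈ S is t + b for b = s ∸ t, so only ∣B∣ of the ∣S∣ jumps from t are lost.
    jumps-avoiding-≥ : ∀ B t → (∀ {s} → s ∈ S → t < s) → length S ∸ length B ≤ length (jumps (avoiding B) t)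
    jumps-avoiding-≥ B t t<S = m≤n+o⇒m∸n≤o (length S) (length B) (begin
      length S ≤⟨ Unique⇒length≤ S! covered ⟩
      length (map (t +_) (B ++ jumps (avoiding B) t)) ≡⟨ length-map (t +_) (B ++ jumps (avoiding B) t) ⟩
      length (B ++ jumps (avoiding B) t) ≡⟨ length-++ B ⟩
      length B + length (jumps (avoiding B) t) ∎)
      where
      open ≤-Reasoning
      covered : ∀ {s} → s ∈ S → s ∈ map (t +_) (B ++ jumps (avoiding B) t)
      covered {s} s∈S = subst (_∈ map (t +_) _) t+b≡s (∈-map⁺ (t +_) b∈)
        where
        t+b≡s : t + (s ∸ t) ≡ s
        t+b≡s = m+[n∸m]≡n (<⇒≤ (t<S s∈S))
        b∈ : s ∸ t ∈ B ++ jumps (avoiding B) t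
        b∈ with s ∸ t ∈? B
        ... | yes b∈B = ∈-++⁺ˡ b∈B
        ... | no b∉B = ∈-++⁺ʳ B (∈-filter⁺ (λ b → t + b ∈? S)
          (∈-filter⁺ (_∉? B) (∈-interval⁺ (m<n⇒0<n∸m (t<S s∈S)) (≤-trans (m∸n≤m s t) (S≤M s∈S))) b∉B)
          (subst (_∈ S) (sym t+b≡s) s∈S))

    -- The elements of `T` make at least |T| (|S| - |B|) ≥ |T| |S| / 2 jumps into `S` that avoid
    -- `B`, spread over at most `M` shifts; some shift receives the average share.
    rich-shift : ∀ B T → 0 < length T → length B + length B < length S →
      (∀ {t s} → t ∈ T → s ∈ S → t < s) →
      ∃[ b ] (b ∉ B × 1 ≤ b × b ≤ M × length T * length S ≤ length (hits T b) * (2 * M))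
    rich-shift B T T>0 2B<S T<S = pick (avoiding B) refl
      where
      open ≤-Reasoning
      d = length S ∸ length B
      f = λ b → length (hits T b)
      S≤2d : length S ≤ d * 2
      S≤2d = +-cancelˡ-≤ (length B + length B) _ _ (begin
        length B + length B + length S ≤⟨ +-monoˡ-≤ (length S) (<⇒≤ 2B<S) ⟩
        length S + length S ≡⟨ cong₂ _+_ S≡B+d S≡B+d ⟩
        (length B + d) + (length B + d) ≡⟨ regroup (length B) d ⟩
        length B + length B + d * 2 ∎)
        where
        S≡B+d = sym (m+[n∸m]≡n (≤-trans (m≤m+n (length B) (length B)) (<⇒≤ 2B<S)))
        regroup : ∀ u v → (u + v) + (u + v) ≡ u + u + v * 2
        regroup = solve-∀
      d>0 : 0 < d
      d>0 = m<n⇒0<n∸m (≤-<-trans (m≤m+n (length B) (length B)) 2B<S)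
      total : length T * d ≤ sum (map f (avoiding B))
      total = ≤-trans (sum-≥ _ d T λ t∈T → jumps-avoiding-≥ B _ (T<S t∈T))
                      (≤-reflexive (double-count (avoiding B) T))
      pick : ∀ R → avoiding B ≡ R →
        ∃[ b ] (b ∉ B × 1 ≤ b × b ≤ M × length T * length S ≤ length (hits T b) * (2 * M))
      -- Without candidate shifts there would be no jumps, but `total` counts at least
      -- `length T * d > 0`.
      pick [] eq = contradiction (subst (λ R → length T * d ≤ sum (map f R)) eq total)
                                   (<⇒≱ (*-mono-≤ T>0 d>0))
      pick (r ∷ R) eq with b , b∈ , le ← average≤value f r R
        with b∈I , b∉B ← ∈-filter⁻ (_∉? B) {xs = interval 0 M} (subst (b ∈_) (sym eq) b∈) =
        b , b∉B , proj₁ (∈-interval⁻ b∈I) , proj₂ (∈-interval⁻ b∈I) , (begin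
          length T * length S ≤⟨ *-monoʳ-≤ (length T) S≤2d ⟩
          length T * (d * 2) ≡⟨ *-assoc (length T) d 2 ⟨
          length T * d * 2 ≤⟨ *-monoˡ-≤ 2 (subst (λ R → length T * d ≤ sum (map f R)) eq total) ⟩
          sum (map f (r ∷ R)) * 2 ≤⟨ *-monoˡ-≤ 2 le ⟩
          length (r ∷ R) * f b * 2 ≤⟨ *-monoˡ-≤ 2 (*-monoˡ-≤ (f b) R≤M) ⟩
          M * f b * 2 ≡⟨ regroup M (f b) ⟩
          f b * (2 * M) ∎)
        where
        regroup : ∀ u v → u * v * 2 ≡ v * (2 * u)
        regroup = solve-∀
        R≤M : length (r ∷ R) ≤ M
        R≤M = begin
          length (r ∷ R) ≡⟨ cong length eq ⟨
          length (avoiding B) ≤⟨ length-filter (_∉? B) (interval 0 M) ⟩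
          length (interval 0 M) ≡⟨ length-applyUpTo _ M ⟩
          M ∎

    -- Each round takes a fresh shift b from `rich-shift` and replaces T by T ∩ (S - b), at the cost
    -- of a factor |S| / (2M). Forbidding the earlier shifts is affordable as `k + k ≤ length S`,
    -- and the bound itself keeps T nonempty for the next round.
    many-shifts : ∀ {X} → Unique X → (∀ {x s} → x ∈ X → s ∈ S → x < s) → 0 < length X →
      ∀ k → k + k ≤ length S →
      ∃[ B ] ∃[ T ] (SubsetUpTo M B × length B ≡ k × Unique T × (∀ {t} → t ∈ T → t ∈ X)
        × (∀ {b t} → b ∈ B → t ∈ T → t + b ∈ S)
        × length X * length S ^ k ≤ length T * (2 * M) ^ k)
    many-shifts {X} X! X<S X>0 zero _ = [] , X , ([] , []) , refl , X! , (λ t∈X → t∈X) , (λ ()) , ≤-refl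
    many-shifts {X} X! X<S X>0 (suc k) 2k≤S
      with many-shifts X! X<S X>0 k (≤-trans (+-mono-≤ (n≤1+n k) (n≤1+n k)) 2k≤S)
    ... | B , T , (B! , B≤M) , refl , T! , T⊆X , T+B⊆S , bound
      with rich-shift B T T>0 (≤-trans (s≤s (+-monoʳ-≤ (length B) (n≤1+n (length B)))) 2k≤S)
                      (λ t∈T → X<S (T⊆X t∈T))
      where
      T>0 : 0 < length T
      T>0 = n≢0⇒n>0 λ T≡0 → <⇒≱
        (*-mono-≤ X>0 (m^n>0 (length S) {{>-nonZero (≤-trans (s≤s z≤n) 2k≤S)}} (length B)))
        (≤-trans bound (≤-reflexive (cong (_* (2 * M) ^ length B) T≡0)))
    ... | b , b∉B , 1≤b , b≤M , rich =
      b ∷ B , hits T b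
        , (All.tabulate (λ b′∈B b≡b′ → b∉B (subst (_∈ B) (sym b≡b′) b′∈B)) ∷ B! , (1≤b , b≤M) ∷ B≤M)
        , refl , Unique.filter⁺ _ T!
        , (λ t∈ → T⊆X (proj₁ (∈-hits⁻ t∈)))
        , (λ { (here refl) t∈ → proj₂ (∈-hits⁻ t∈) ; (there b′∈B) t∈ → T+B⊆S b′∈B (proj₁ (∈-hits⁻ t∈)) })
        , (begin
            length X * (length S * length S ^ k′) ≡⟨ regroup (length X) (length S) (length S ^ k′) ⟩
            length X * length S ^ k′ * length S ≤⟨ *-monoˡ-≤ (length S) bound ⟩
            length T * (2 * M) ^ k′ * length S ≡⟨ regroup′ (length T) ((2 * M) ^ k′) (length S) ⟩
            length T * length S * (2 * M) ^ k′ ≤⟨ *-monoˡ-≤ ((2 * M) ^ k′) rich ⟩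
            length (hits T b) * (2 * M) * (2 * M) ^ k′ ≡⟨ *-assoc (length (hits T b)) (2 * M) _ ⟩
            length (hits T b) * (2 * M * (2 * M) ^ k′) ∎)
      where
      open ≤-Reasoning
      k′ = length B
      ∈-hits⁻ : ∀ {t} → t ∈ hits T b → t ∈ T × t + b ∈ S
      ∈-hits⁻ = ∈-filter⁻ (λ t → t + b ∈? S) {xs = T}
      regroup : ∀ u v w → u * (v * w) ≡ u * w * v
      regroup = solve-∀
      regroup′ : ∀ u v w → u * v * w ≡ u * w * v
      regroup′ = solve-∀

-- Binomial coefficients

-- choose i j is the binomial coefficient (i + j choose i).
choose : ℕ → ℕ → ℕ
choose zero j = 1
choose (suc i) zero = 1
choose (suc i) (suc j) = choose i (suc j) + choose (suc i) j

choose-zeroʳ : ∀ i → choose i 0 ≡ 1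
choose-zeroʳ zero = refl
choose-zeroʳ (suc i) = refl

choose-oneˡ : ∀ j → choose 1 j ≡ suc j
choose-oneˡ zero = refl
choose-oneˡ (suc j) = cong suc (choose-oneˡ j)

-- Under Pascal's rule the two summands account for the shares `suc i` and `suc j` of the top factor
-- of `(suc i + suc j) !`.
choose-! : ∀ i j → choose i j * (i ! * j !) ≡ (i + j) !
choose-! zero j = trans (+-identityʳ _) (+-identityʳ _)
choose-! (suc i) zero = trans (+-identityʳ _) (trans (*-identityʳ _) (cong (λ k → suc k !) (sym (+-identityʳ i))))
choose-! (suc i) (suc j) = begin
  (choose i (suc j) + choose (suc i) j) * (suc i ! * suc j !)
    ≡⟨ expand (choose i (suc j)) (choose (suc i) j) i (i !) j (j !) ⟩
  suc i * (choose i (suc j) * (i ! * suc j !)) + suc j * (choose (suc i) j * (suc i ! * j !))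
    ≡⟨ cong₂ (λ u v → suc i * u + suc j * v) (trans (choose-! i (suc j)) (cong _! (+-suc i j))) (choose-! (suc i) j) ⟩
  suc i * (suc i + j) ! + suc j * (suc i + j) !
    ≡⟨ *-distribʳ-+ ((suc i + j) !) (suc i) (suc j) ⟨
  (suc i + suc j) * (suc i + j) !
    ≡⟨ cong (λ k → (suc i + suc j) * k !) (+-suc i j) ⟨
  (suc i + suc j) ! ∎
  where
  open ≡-Reasoning
  expand : ∀ a b i i! j j! → (a + b) * (((1 + i) * i!) * ((1 + j) * j!))
         ≡ (1 + i) * (a * (i! * ((1 + j) * j!))) + (1 + j) * (b * (((1 + i) * i!) * j!))
  expand = solve-∀

-- Multiplied by `i ! * j !`, both sides become `(suc i + j) !`; the same holds for
-- `choose-absorbʳ`.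
choose-absorbˡ : ∀ i j → suc i * choose (suc i) j ≡ (suc i + j) * choose i j
choose-absorbˡ i j = *-cancelʳ-≡ _ _ (i ! * j !) {{m*n≢0 (i !) (j !) {{i !≢0}} {{j !≢0}}}} (begin
  suc i * choose (suc i) j * (i ! * j !) ≡⟨ regroup i (choose (suc i) j) (i !) (j !) ⟩
  choose (suc i) j * (suc i ! * j !) ≡⟨ choose-! (suc i) j ⟩
  (suc i + j) * (i + j) ! ≡⟨ cong ((suc i + j) *_) (choose-! i j) ⟨
  (suc i + j) * (choose i j * (i ! * j !)) ≡⟨ *-assoc (suc i + j) (choose i j) _ ⟨
  (suc i + j) * choose i j * (i ! * j !) ∎)
  where
  open ≡-Reasoning
  regroup : ∀ i c a b → (1 + i) * c * (a * b) ≡ c * (((1 + i) * a) * b)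
  regroup = solve-∀

choose-absorbʳ : ∀ i j → suc i * choose (suc i) j ≡ suc j * choose i (suc j)
choose-absorbʳ i j = *-cancelʳ-≡ _ _ (i ! * j !) {{m*n≢0 (i !) (j !) {{i !≢0}} {{j !≢0}}}} (begin
  suc i * choose (suc i) j * (i ! * j !) ≡⟨ regroup i (choose (suc i) j) (i !) (j !) ⟩
  choose (suc i) j * (suc i ! * j !) ≡⟨ choose-! (suc i) j ⟩
  (suc i + j) ! ≡⟨ cong _! (+-suc i j) ⟨
  (i + suc j) ! ≡⟨ choose-! i (suc j) ⟨
  choose i (suc j) * (i ! * suc j !) ≡⟨ regroup′ j (choose i (suc j)) (i !) (j !) ⟩
  suc j * choose i (suc j) * (i ! * j !) ∎)
  where
  open ≡-Reasoning
  regroup : ∀ i c a b → (1 + i) * c * (a * b) ≡ c * (((1 + i) * a) * b)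
  regroup = solve-∀
  regroup′ : ∀ j c a b → c * (a * ((1 + j) * b)) ≡ (1 + j) * c * (a * b)
  regroup′ = solve-∀

choose-monoˡ : ∀ i j → choose i j ≤ choose (suc i) j
choose-monoˡ i zero = ≤-reflexive (choose-zeroʳ i)
choose-monoˡ i (suc j) = m≤m+n _ _

choose-monoʳ : ∀ i j → choose i j ≤ choose i (suc j)
choose-monoʳ zero j = ≤-refl
choose-monoʳ (suc i) j = m≤n+m _ _

choose≤2^ : ∀ i j → choose i j ≤ 2 ^ (i + j)
choose≤2^ zero j = m^n>0 2 j
choose≤2^ (suc i) zero = m^n>0 2 (suc (i + 0))
choose≤2^ (suc i) (suc j) = begin
  choose i (suc j) + choose (suc i) j ≤⟨ +-mono-≤ (choose≤2^ i (suc j)) (choose≤2^ (suc i) j) ⟩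
  2 ^ (i + suc j) + 2 ^ (suc i + j) ≡⟨ cong (λ k → 2 ^ (i + suc j) + 2 ^ k) (+-suc i j) ⟨
  2 ^ (i + suc j) + 2 ^ (i + suc j) ≡⟨ cong (2 ^ (i + suc j) +_) (+-identityʳ _) ⟨
  2 ^ (suc i + suc j) ∎
  where open ≤-Reasoning

-- Pascal's rule splits the next central coefficient into two terms, each at least `choose n n`, so
-- it at least doubles.
2^≤choose : ∀ n → 2 ^ n ≤ choose n n
2^≤choose zero = ≤-refl
2^≤choose (suc n) = begin
  2 ^ n + (2 ^ n + 0) ≡⟨ cong (2 ^ n +_) (+-identityʳ _) ⟩
  2 ^ n + 2 ^ n ≤⟨ +-mono-≤ (2^≤choose n) (2^≤choose n) ⟩
  choose n n + choose n n ≤⟨ +-mono-≤ (choose-monoʳ n n) (choose-monoˡ n n) ⟩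
  choose n (suc n) + choose (suc n) n ∎
  where open ≤-Reasoning

-- The fractions 1 / (suc i * choose (suc i) j) form the Leibniz harmonic triangle, in which each
-- entry is a difference of two entries with smaller i; clearing denominators, a common multiple of
-- 1, …, n is a multiple of every denominator in the first n rows.
harmonic-triangle-∣ : ∀ {n Q} → (∀ m → suc m ≤ n → suc m ∣ Q) →
  ∀ i j → suc i + j ≤ n → suc i * choose (suc i) j ∣ Q
harmonic-triangle-∣ {n} {Q} ∣Q zero j j<n = subst (_∣ Q) (sym (trans (*-identityˡ _) (choose-oneˡ j))) (∣Q j j<n)
harmonic-triangle-∣ {n} {Q} ∣Q (suc i) j r≤n
  with divides a Q≡aD ← harmonic-triangle-∣ ∣Q i j (≤-trans (n≤1+n _) r≤n)
  with divides b Q≡bD ← harmonic-triangle-∣ ∣Q i (suc j) (subst (_≤ n) (cong suc (sym (+-suc i j))) r≤n) =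
  divides (a ∸ b) (*-cancelˡ-≡ _ _ (suc i) (sym (begin
    suc i * ((a ∸ b) * D) ≡⟨ cong (suc i *_) (*-distribʳ-∸ D a b) ⟩
    suc i * (a * D ∸ b * D) ≡⟨ *-distribˡ-∸ (suc i) (a * D) (b * D) ⟩
    suc i * (a * D) ∸ suc i * (b * D) ≡⟨ cong₂ _∸_ aD bD ⟩
    (suc i + suc j) * Q ∸ suc j * Q ≡⟨ *-distribʳ-∸ Q (suc i + suc j) (suc j) ⟨
    ((suc i + suc j) ∸ suc j) * Q ≡⟨ cong (_* Q) (m+n∸n≡m (suc i) (suc j)) ⟩
    suc i * Q ∎)))
  where
  open ≡-Reasoning
  D = suc (suc i) * choose (suc (suc i)) j
  regroup : ∀ i a r c → (1 + i) * (a * (r * c)) ≡ r * (a * ((1 + i) * c))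
  regroup = solve-∀
  aD : suc i * (a * D) ≡ (suc i + suc j) * Q
  aD = begin
    suc i * (a * D) ≡⟨ cong (λ d → suc i * (a * d)) (choose-absorbˡ (suc i) j) ⟩
    suc i * (a * ((suc (suc i) + j) * choose (suc i) j)) ≡⟨ regroup i a (suc (suc i) + j) (choose (suc i) j) ⟩
    (suc (suc i) + j) * (a * (suc i * choose (suc i) j)) ≡⟨ cong₂ _*_ (cong suc (sym (+-suc i j))) (sym Q≡aD) ⟩
    (suc i + suc j) * Q ∎
  bD : suc i * (b * D) ≡ suc j * Q
  bD = begin
    suc i * (b * D) ≡⟨ cong (λ d → suc i * (b * d)) (choose-absorbʳ (suc i) j) ⟩
    suc i * (b * (suc j * choose (suc i) (suc j))) ≡⟨ regroup i b (suc j) (choose (suc i) (suc j)) ⟩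
    suc j * (b * (suc i * choose (suc i) (suc j))) ≡⟨ cong (suc j *_) (sym Q≡bD) ⟩
    suc j * Q ∎

-- Chebyshev bounds

-- Euclid's lemma puts one factor `p` into `n`; cancelling it lowers the exponent.
prime∤⇒^∣ : ∀ {p m} → Prime p → ¬ p ∣ m → ∀ k {n} → p ^ k ∣ m * n → p ^ k ∣ n
prime∤⇒^∣ pp p∤m zero _ = 1∣ _
prime∤⇒^∣ {p} {m} pp p∤m (suc k) {n} p^∣ with euclidsLemma m n pp (m*n∣⇒m∣ p (p ^ k) p^∣)
... | inj₁ p∣m = contradiction p∣m p∤m
... | inj₂ (divides q refl) = subst (p * p ^ k ∣_) (*-comm p q) (*-monoʳ-∣ p (prime∤⇒^∣ pp p∤m k
    (*-cancelˡ-∣ p {{prime⇒nonZero pp}} (subst (p * p ^ k ∣_) (regroup m q p) p^∣))))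
  where
  regroup : ∀ m q p → m * (q * p) ≡ p * (m * q)
  regroup = solve-∀

prime∣prime⇒≡ : ∀ {p q} → Prime p → Prime q → p ∣ q → p ≡ q
prime∣prime⇒≡ pp pq p∣q with prime⇒irreducible pq p∣q
... | inj₁ refl = contradiction pp ¬prime[1]
... | inj₂ p≡q = p≡q

-- Induction on the factors. With `Q ≡ p * Q′` the hypothesis passes to `Q′`: a power of `p` itself
-- comes with one extra factor `p` to cancel, and for a power of another prime the factor `p` is
-- irrelevant.
prime-powers-∣⇒product-∣ : ∀ {ps} → All Prime ps → ∀ {Q} →
  (∀ {p} k → Prime p → p ^ k ∣ product ps → p ^ k ∣ Q) → product ps ∣ Q
prime-powers-∣⇒product-∣ [] _ = 1∣ _
prime-powers-∣⇒product-∣ {p ∷ ps} (pp ∷ pps) {Q} ^∣Q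
  with divides Q′ Q≡Q′p ← m*n∣⇒m∣ p 1 (^∣Q 1 pp (*-monoʳ-∣ p (1∣ product ps))) =
  subst (p * product ps ∣_) (sym Q≡pQ′) (*-monoʳ-∣ p (prime-powers-∣⇒product-∣ pps ^∣Q′))
  where
  Q≡pQ′ : Q ≡ p * Q′
  Q≡pQ′ = trans Q≡Q′p (*-comm Q′ p)
  ^∣Q′ : ∀ {r} k → Prime r → r ^ k ∣ product ps → r ^ k ∣ Q′
  ^∣Q′ {r} k pr r^k∣ with r ≟ p
  ... | yes refl = *-cancelˡ-∣ p {{prime⇒nonZero pp}}
          (subst (p * p ^ k ∣_) Q≡pQ′ (^∣Q (suc k) pp (*-monoʳ-∣ p r^k∣)))
  ... | no r≢p = prime∤⇒^∣ pr (r≢p ∘ prime∣prime⇒≡ pr pp) k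
          (subst (r ^ k ∣_) Q≡pQ′ (^∣Q k pr (∣n⇒∣m*n p r^k∣)))

prime-powers-∣⇒∣ : ∀ {m Q} → .{{NonZero m}} → (∀ {p} k → Prime p → p ^ k ∣ m → p ^ k ∣ Q) → m ∣ Q
prime-powers-∣⇒∣ {m} {Q} ^∣Q = subst (_∣ Q) (sym isFactorisation)
  (prime-powers-∣⇒product-∣ factorsPrime λ k pp → ^∣Q k pp ∘ subst (_ ∣_) (sym isFactorisation))
  where open PrimeFactorisation (factorise m)

-- For prime `p` and `e = n` this is the `p`-part of lcm (1, ..., n): `p ^ k ≤ n` with `p ≥ 2`
-- forces `k ≤ n`, so the search down from exponent `n` misses nothing.
largestPower : ℕ → ℕ → ℕ → ℕ
largestPower p n zero = 1
largestPower p n (suc e) with p ^ suc e ≤? n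
... | yes _ = p ^ suc e
... | no _ = largestPower p n e

largestPower≤ : ∀ p {n} → 1 ≤ n → ∀ e → largestPower p n e ≤ n
largestPower≤ p 1≤n zero = 1≤n
largestPower≤ p {n} 1≤n (suc e) with p ^ suc e ≤? n
... | yes p^≤n = p^≤n
... | no _ = largestPower≤ p 1≤n e

^-monoʳ-∣ : ∀ p {k l} → k ≤ l → p ^ k ∣ p ^ l
^-monoʳ-∣ p {k} {l} k≤l = divides (p ^ (l ∸ k))
  (trans (cong (p ^_) (sym (m∸n+n≡m k≤l))) (^-distribˡ-+-* p (l ∸ k) k))

∣largestPower : ∀ p {n} e {k} → k ≤ e → p ^ k ≤ n → p ^ k ∣ largestPower p n e
∣largestPower p zero z≤n _ = ∣-refl
∣largestPower p {n} (suc e) {k} k≤1+e p^k≤n with p ^ suc e ≤? n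
... | yes _ = ^-monoʳ-∣ p k≤1+e
... | no p^≰n = ∣largestPower p e (≤-pred (≤∧≢⇒< k≤1+e λ { refl → p^≰n p^k≤n })) p^k≤n

n<2^n : ∀ n → n < 2 ^ n
n<2^n zero = s≤s z≤n
n<2^n (suc n) = begin-strict
  suc n ≤⟨ n<2^n n ⟩
  2 ^ n <⟨ m<m+n (2 ^ n) (m^n>0 2 n) ⟩
  2 ^ n + 2 ^ n ≡⟨ cong (2 ^ n +_) (+-identityʳ _) ⟨
  2 ^ suc n ∎
  where open ≤-Reasoning

prime≥2 : ∀ {p} → Prime p → 2 ≤ p
prime≥2 {p} pp = nonTrivial⇒n>1 p {{prime⇒nonTrivial pp}}

primes : ℕ → ℕ → List ℕ
primes a n = filter prime? (interval a n)

∈-primes⁺ : ∀ {a n p} → Prime p → a < p → p ≤ a + n → p ∈ primes a n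
∈-primes⁺ pp a<p p≤a+n = ∈-filter⁺ prime? (∈-interval⁺ a<p p≤a+n) pp

∈-primes⁻ : ∀ {a n p} → p ∈ primes a n → Prime p × a < p × p ≤ a + n
∈-primes⁻ {a} {n} p∈ with p∈I , pp ← ∈-filter⁻ prime? {xs = interval a n} p∈ = pp , ∈-interval⁻ p∈I

primes! : ∀ a n → Unique (primes a n)
primes! a n = Unique.filter⁺ prime? (interval! a n)

length-primes≤ : ∀ a n → length (primes a n) ≤ n
length-primes≤ a n = ≤-trans (length-filter prime? (interval a n)) (≤-reflexive (length-applyUpTo _ n))

length-primes-+ : ∀ m n → length (primes 0 (m + n)) ≤ length (primes 0 m) + length (primes m n)
length-primes-+ m n = ≤-trans (Unique⇒length≤ (primes! 0 (m + n)) split)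
                              (≤-reflexive (length-++ (primes 0 m)))
  where
  split : ∀ {p} → p ∈ primes 0 (m + n) → p ∈ primes 0 m ++ primes m n
  split {p} p∈ with pp , 0<p , p≤ ← ∈-primes⁻ {0} {m + n} p∈ with p ≤? m
  ... | yes p≤m = ∈-++⁺ˡ (∈-primes⁺ {0} {m} pp 0<p p≤m)
  ... | no p≰m = ∈-++⁺ʳ (primes 0 m) (∈-primes⁺ {m} {n} pp (≰⇒> p≰m) p≤)

product-map≤ : ∀ (f : ℕ → ℕ) {c} xs → (∀ x → f x ≤ c) → product (map f xs) ≤ c ^ length xs
product-map≤ f [] _ = ≤-refl
product-map≤ f (x ∷ xs) f≤c = *-mono-≤ (f≤c x) (product-map≤ f xs f≤c)

^≤product : ∀ {c xs} → All (c ≤_) xs → c ^ length xs ≤ product xs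
^≤product [] = ≤-refl
^≤product (c≤x ∷ c≤xs) = *-mono-≤ c≤x (^≤product c≤xs)

-- This is lcm (1, ..., n), written with one factor of size at most `n` for each prime up to `n`.
primePowerProduct : ℕ → ℕ
primePowerProduct n = product (map (λ p → largestPower p n n) (primes 0 n))

-- Divisibility can be tested on prime powers, and a power of `p` dividing `suc m` is at most `n`,
-- so it divides the factor belonging to `p`.
∣primePowerProduct : ∀ {n} m → suc m ≤ n → suc m ∣ primePowerProduct n
∣primePowerProduct {n} m m<n = prime-powers-∣⇒∣ power∣
  where
  power∣ : ∀ {p} k → Prime p → p ^ k ∣ suc m → p ^ k ∣ primePowerProduct n
  power∣ zero _ _ = 1∣ _
  power∣ {p} (suc k) pp p^∣ = ∣-trans
    (∣largestPower p n k≤n p^≤n)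
    (∈⇒∣product (∈-map⁺ (λ p → largestPower p n n) (∈-primes⁺ pp (<-trans (s≤s z≤n) (prime≥2 pp)) p≤n)))
    where
    p^≤n : p ^ suc k ≤ n
    p^≤n = ≤-trans (∣⇒≤ p^∣) m<n
    p≤n : p ≤ n
    p≤n = ≤-trans (∣⇒≤ (m*n∣⇒m∣ p (p ^ k) p^∣)) m<n
    k≤n : suc k ≤ n
    k≤n = ≤-trans (<⇒≤ (n<2^n (suc k))) (≤-trans (^-monoˡ-≤ (suc k) (prime≥2 pp)) p^≤n)

largestPower>0 : ∀ {p} n e → 1 ≤ p → 0 < largestPower p n e
largestPower>0 n zero 1≤p = s≤s z≤n
largestPower>0 {p} n (suc e) 1≤p with p ^ suc e ≤? n
... | yes _ = m^n>0 p {{>-nonZero 1≤p}} (suc e)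
... | no _ = largestPower>0 n e 1≤p

primePowerProduct≢0 : ∀ n → NonZero (primePowerProduct n)
primePowerProduct≢0 n = product≢0 (All.map⁺ (All.tabulate λ p∈ →
  >-nonZero (largestPower>0 n n (proj₁ (proj₂ (∈-primes⁻ {0} {n} p∈))))))

2^-reflects-≤ : ∀ {m n} → 2 ^ m ≤ 2 ^ n → m ≤ n
2^-reflects-≤ 2^m≤2^n = ≮⇒≥ λ n<m → <⇒≱ (^-monoʳ-< 2 (s≤s (s≤s z≤n)) n<m) 2^m≤2^n

-- At a power of two, the outer terms of 2 ^ m ≤ (2m choose m) ≤ lcm (1, ..., 2m) ≤ (2m) ^ π(2m) are
-- both powers of 2, and comparing exponents replaces taking logarithms.
chebyshev-lower : ∀ j → 2 ^ j ≤ suc j * length (primes 0 (2 ^ suc j))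
chebyshev-lower j = 2^-reflects-≤ (begin
  2 ^ (2 ^ j) ≤⟨ 2^≤choose (2 ^ j) ⟩
  choose (2 ^ j) (2 ^ j) ≤⟨ ∣⇒≤ {{primePowerProduct≢0 N}} (central∣ (2 ^ j) (m^n>0 2 j) ≤-refl) ⟩
  primePowerProduct N ≤⟨ product-map≤ _ (primes 0 N) (λ p → largestPower≤ p (m^n>0 2 (suc j)) N) ⟩
  N ^ length (primes 0 N) ≡⟨ ^-*-assoc 2 (suc j) (length (primes 0 N)) ⟩
  2 ^ (suc j * length (primes 0 N)) ∎)
  where
  open ≤-Reasoning
  N = 2 ^ suc j
  -- Generalised from `2 ^ j`, which does not reduce to a successor. The harmonic triangle gives the
  -- stronger divisor `suc n * choose (suc n) (suc n)`.
  central∣ : ∀ n → 0 < n → 2 * n ≤ N → choose n n ∣ primePowerProduct N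
  central∣ (suc n) _ 2n≤N = ∣-trans (n∣m*n (suc n)) (harmonic-triangle-∣ ∣primePowerProduct n (suc n)
    (≤-trans (≤-reflexive (cong (suc n +_) (sym (+-identityʳ (suc n))))) 2n≤N))

-- Write `n` as `q * product ps`. If the new prime divided `product ps` it would occur in `ps`, so
-- it divides `q`.
distinct-primes-∣ : ∀ {ps n} → Unique ps → All Prime ps → All (_∣ n) ps → product ps ∣ n
distinct-primes-∣ [] [] [] = 1∣ _
distinct-primes-∣ {p ∷ ps} (p∉ps ∷ ps!) (pp ∷ pps) (p∣n ∷ ps∣n)
  with divides q refl ← distinct-primes-∣ ps! pps ps∣n
  with euclidsLemma q (product ps) pp p∣n
... | inj₁ p∣q = *-monoˡ-∣ (product ps) p∣q
... | inj₂ p∣Π = contradiction refl (All.lookup p∉ps (factorisationHasAllPrimeFactors pp p∣Π pps))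

prime∣!⇒≤ : ∀ {p} n → Prime p → p ∣ n ! → p ≤ n
prime∣!⇒≤ zero pp p∣1 = contradiction (subst Prime (∣1⇒≡1 p∣1) pp) ¬prime[1]
prime∣!⇒≤ (suc n) pp p∣ with euclidsLemma (suc n) (n !) pp p∣
... | inj₁ p∣1+n = ∣⇒≤ p∣1+n
... | inj₂ p∣n! = m≤n⇒m≤1+n (prime∣!⇒≤ n pp p∣n!)

-- In (2n)! = (2n choose n) n! n! the prime divides the left side as `p ≤ n + n`, but not `n !` as
-- `n < p`.
prime∣choose : ∀ {p} n → Prime p → n < p → p ≤ n + n → p ∣ choose n n
prime∣choose {suc p} n pp n<p p≤2n with euclidsLemma (choose n n) (n ! * n !) pp
  (subst (suc p ∣_) (sym (choose-! n n)) (∣-trans (m∣m*n (p !)) (m≤n⇒m!∣n! p≤2n)))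
... | inj₁ p∣c = p∣c
... | inj₂ p∣n!n! with euclidsLemma (n !) (n !) pp p∣n!n!
...   | inj₁ p∣n! = contradiction (prime∣!⇒≤ n pp p∣n!) (<⇒≱ n<p)
...   | inj₂ p∣n! = contradiction (prime∣!⇒≤ n pp p∣n!) (<⇒≱ n<p)
prime∣choose {zero} n pp n<p p≤2n = contradiction pp ¬prime[0]

choose>0 : ∀ i j → 0 < choose i j
choose>0 zero j = s≤s z≤n
choose>0 (suc i) j = ≤-trans (choose>0 i j) (choose-monoˡ i j)

-- With n = 2 ^ j, the primes in (n, 2n] all exceed n and their product divides (2n choose n) ≤ 2 ^
-- (2n); the bound compares exponents of 2.
dyadic-primes-upper : ∀ j → j * length (primes (2 ^ j) (2 ^ j)) ≤ 2 ^ j + 2 ^ j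
dyadic-primes-upper j = 2^-reflects-≤ (begin
  2 ^ (j * length P) ≡⟨ ^-*-assoc 2 j (length P) ⟨
  n ^ length P ≤⟨ ^≤product (All.tabulate λ p∈ → <⇒≤ (proj₁ (proj₂ (∈-primes⁻ {n} {n} p∈)))) ⟩
  product P ≤⟨ ∣⇒≤ {{>-nonZero (choose>0 n n)}} (distinct-primes-∣ (primes! n n)
                (All.tabulate λ p∈ → proj₁ (∈-primes⁻ {n} {n} p∈))
                (All.tabulate λ p∈ → let pp , n<p , p≤2n = ∈-primes⁻ {n} {n} p∈ in prime∣choose n pp n<p p≤2n)) ⟩
  choose n n ≤⟨ choose≤2^ n n ⟩
  2 ^ (n + n) ∎)
  where
  open ≤-Reasoning
  n = 2 ^ j
  P = primes n n

-- The constant 4 reproduces itself under doubling: the primes up to n contribute 4n, those in (n,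
-- 2n] contribute 2n, and raising the factor `j` to `suc j` costs at most 2n, in total 8n = 4 (2n).
chebyshev-upper : ∀ j → j * length (primes 0 (2 ^ j)) ≤ 4 * 2 ^ j
chebyshev-upper zero = z≤n
chebyshev-upper (suc j) = begin
  suc j * length (primes 0 (2 ^ suc j)) ≡⟨ cong (λ m → suc j * length (primes 0 (n + m))) (+-identityʳ n) ⟩
  suc j * length (primes 0 (n + n)) ≤⟨ *-monoʳ-≤ (suc j) (length-primes-+ n n) ⟩
  suc j * (u + v) ≡⟨ expand j u v ⟩
  j * u + j * v + (u + v) ≤⟨ +-mono-≤ (+-mono-≤ (chebyshev-upper j) (dyadic-primes-upper j))
                                      (+-mono-≤ (length-primes≤ 0 n) (length-primes≤ n n)) ⟩
  4 * n + (n + n) + (n + n) ≡⟨ collect n ⟩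
  4 * 2 ^ suc j ∎
  where
  open ≤-Reasoning
  n = 2 ^ j
  u = length (primes 0 n)
  v = length (primes n n)
  expand : ∀ j u v → (1 + j) * (u + v) ≡ j * u + j * v + (u + v)
  expand = solve-∀
  collect : ∀ n → 4 * n + (n + n) + (n + n) ≡ 4 * (2 * n)
  collect = solve-∀

-- Weighted by `5 + j`, the primes up to 32n count at least 16n and those up to n at most 5n + 4n,
-- which leaves more than n. With 16 in place of 32 these estimates would leave nothing.
primes-in-window : ∀ j → 2 ^ j ≤ (5 + j) * length (primes (2 ^ j) (31 * 2 ^ j))
primes-in-window j = +-cancelˡ-≤ (9 * n) _ _ (begin
  9 * n + n ≤⟨ ≤-trans (m≤m+n (9 * n + n) (6 * n)) (≤-reflexive (collect n)) ⟩
  2 ^ (4 + j) ≤⟨ chebyshev-lower (4 + j) ⟩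
  (5 + j) * length (primes 0 (2 ^ (5 + j))) ≡⟨ cong (λ m → (5 + j) * length (primes 0 m)) (split n) ⟩
  (5 + j) * length (primes 0 (n + 31 * n)) ≤⟨ *-monoʳ-≤ (5 + j) (length-primes-+ n (31 * n)) ⟩
  (5 + j) * (u + v) ≡⟨ expand j u v ⟩
  5 * u + j * u + (5 + j) * v ≤⟨ +-monoˡ-≤ ((5 + j) * v) (+-mono-≤ (*-monoʳ-≤ 5 (length-primes≤ 0 n)) (chebyshev-upper j)) ⟩
  5 * n + 4 * n + (5 + j) * v ≡⟨ cong (_+ (5 + j) * v) (*-distribʳ-+ n 5 4) ⟨
  9 * n + (5 + j) * v ∎)
  where
  open ≤-Reasoning
  n = 2 ^ j
  u = length (primes 0 n)
  v = length (primes n (31 * n))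
  collect : ∀ n → 9 * n + n + 6 * n ≡ 2 * (2 * (2 * (2 * n)))
  collect = solve-∀
  split : ∀ n → 2 * (2 * (2 * (2 * (2 * n)))) ≡ n + 31 * n
  split = solve-∀
  expand : ∀ j u v → (5 + j) * (u + v) ≡ 5 * u + j * u + (5 + j) * v
  expand = solve-∀

-- Dyadic scales and exponential growth

^-distribʳ-* : ∀ k m n → (m * n) ^ k ≡ m ^ k * n ^ k
^-distribʳ-* zero m n = refl
^-distribʳ-* (suc k) m n = trans (cong (m * n *_) (^-distribʳ-* k m n)) (regroup m n (m ^ k) (n ^ k))
  where
  regroup : ∀ a b c d → a * b * (c * d) ≡ a * c * (b * d)
  regroup = solve-∀

m≤m^n : ∀ m n .{{_ : NonZero m}} .{{_ : NonZero n}} → m ≤ m ^ n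
m≤m^n m (suc n) = m≤m*n m (m ^ n) {{m^n≢0 m n}}

2^⌊log₂n⌋≤n : ∀ n → 1 ≤ n → 2 ^ ⌊log₂ n ⌋ ≤ n
2^⌊log₂n⌋≤n = <-rec _ λ where
    zero _ ()
    (suc zero) _ _ → ≤-refl
    (suc (suc m)) rec _ → step m (rec (⌊n/2⌋<n (suc m)) (s≤s z≤n))
  where
  open ≤-Reasoning
  step : ∀ m → let n = suc (suc m) in 2 ^ ⌊log₂ ⌊ n /2⌋ ⌋ ≤ ⌊ n /2⌋ → 2 ^ ⌊log₂ n ⌋ ≤ n
  step m ih = begin
    2 ^ ⌊log₂ n ⌋ ≡⟨ cong (2 ^_) (m+[n∸m]≡n (⌊log₂⌋-mono-≤ {2} {n} (s≤s (s≤s z≤n)))) ⟨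
    2 * 2 ^ (⌊log₂ n ⌋ ∸ 1) ≡⟨ cong (λ k → 2 * 2 ^ k) (⌊log₂⌊n/2⌋⌋≡⌊log₂n⌋∸1 n) ⟨
    2 * 2 ^ ⌊log₂ ⌊ n /2⌋ ⌋ ≤⟨ *-monoʳ-≤ 2 ih ⟩
    ⌊ n /2⌋ + (⌊ n /2⌋ + 0) ≡⟨ cong (⌊ n /2⌋ +_) (+-identityʳ _) ⟩
    ⌊ n /2⌋ + ⌊ n /2⌋ ≤⟨ +-monoʳ-≤ ⌊ n /2⌋ (⌊n/2⌋≤⌈n/2⌉ n) ⟩
    ⌊ n /2⌋ + ⌈ n /2⌉ ≡⟨ ⌊n/2⌋+⌈n/2⌉≡n n ⟩
    n ∎
    where n = suc (suc m)

n<2^[1+⌊log₂n⌋] : ∀ n → n < 2 ^ suc ⌊log₂ n ⌋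
n<2^[1+⌊log₂n⌋] n = ≰⇒> λ 2^≤n → 1+n≰n
  (≤-trans (≤-reflexive (sym (⌊log₂[2^n]⌋≡n (suc ⌊log₂ n ⌋)))) (⌊log₂⌋-mono-≤ 2^≤n))

-- With t = L / (d + 1), 2 ^ L ≥ (2 ^ t) ^ (d + 1) ≥ (t + 1) ^ (d + 1) while L ≤ (t + 1) * (d + 1).
polynomial≤2^ : ∀ M d → ∃[ L₀ ] (∀ L → L₀ ≤ L → M * L ^ d ≤ 2 ^ L)
polynomial≤2^ M d = K * e , bound
  where
  open ≤-Reasoning
  e = suc d
  K = M * e ^ d
  bound : ∀ L → K * e ≤ L → M * L ^ d ≤ 2 ^ L
  bound L Ke≤L = begin
    M * L ^ d ≤⟨ *-monoʳ-≤ M (^-monoˡ-≤ d L≤) ⟩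
    M * (e * suc t) ^ d ≡⟨ cong (M *_) (^-distribʳ-* d e (suc t)) ⟩
    M * (e ^ d * suc t ^ d) ≡⟨ *-assoc M (e ^ d) _ ⟨
    -- The threshold for `L` gives `K ≤ t`, so the constant is absorbed into one more factor
    -- `suc t`.
    K * suc t ^ d ≤⟨ *-monoˡ-≤ (suc t ^ d) (m≤n⇒m≤1+n K≤t) ⟩
    suc t ^ e ≤⟨ ^-monoˡ-≤ e (n<2^n t) ⟩
    (2 ^ t) ^ e ≡⟨ ^-*-assoc 2 t e ⟩
    2 ^ (t * e) ≤⟨ ^-monoʳ-≤ 2 te≤L ⟩
    2 ^ L ∎
    where
    t = L / e
    L≡ = m≡m%n+[m/n]*n L e
    te≤L : t * e ≤ L
    te≤L = ≤-trans (m≤n+m (t * e) (L % e)) (≤-reflexive (sym L≡))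
    L≤ : L ≤ e * suc t
    L≤ = begin
      L ≡⟨ L≡ ⟩
      L % e + t * e ≤⟨ +-monoˡ-≤ (t * e) (<⇒≤ (m%n<n L e)) ⟩
      suc t * e ≡⟨ *-comm (suc t) e ⟩
      e * suc t ∎
    K≤t : K ≤ t
    K≤t = ≤-trans (≤-reflexive (sym (m*n/n≡m K e))) (/-monoˡ-≤ e Ke≤L)

-- Two rounds of shifts

-- Translates the bound of `many-shifts` with `M = c * n` into densities: each shift costs a factor
-- 2cn / s ≤ 2cD.
density-after-shifts : ∀ {h s t n} c D k .{{_ : NonZero n}} → n ≤ D * s →
  h * s ^ k ≤ t * (2 * (c * n)) ^ k → h ≤ t * (2 * c * D) ^ k
density-after-shifts {h} {s} {t} {n} c D k n≤Ds shifts = *-cancelʳ-≤ _ _ (n ^ k) {{m^n≢0 n k}} (begin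
  h * n ^ k ≤⟨ *-monoʳ-≤ h (^-monoˡ-≤ k n≤Ds) ⟩
  h * (D * s) ^ k ≡⟨ cong (h *_) (^-distribʳ-* k D s) ⟩
  h * (D ^ k * s ^ k) ≡⟨ regroup h (D ^ k) (s ^ k) ⟩
  D ^ k * (h * s ^ k) ≤⟨ *-monoʳ-≤ (D ^ k) shifts ⟩
  D ^ k * (t * (2 * (c * n)) ^ k) ≡⟨ regroup (D ^ k) t _ ⟩
  t * (D ^ k * (2 * (c * n)) ^ k) ≡⟨ cong (t *_) (^-distribʳ-* k D (2 * (c * n))) ⟨
  t * (D * (2 * (c * n))) ^ k ≡⟨ cong (λ m → t * m ^ k) (regroup′ D c n) ⟩
  t * (2 * c * D * n) ^ k ≡⟨ cong (t *_) (^-distribʳ-* k (2 * c * D) n) ⟩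
  t * ((2 * c * D) ^ k * n ^ k) ≡⟨ *-assoc t _ _ ⟨
  t * (2 * c * D) ^ k * n ^ k ∎)
  where
  open ≤-Reasoning
  regroup : ∀ u v w → u * (v * w) ≡ v * (u * w)
  regroup = solve-∀
  regroup′ : ∀ D c n → D * (2 * (c * n)) ≡ 2 * c * D * n
  regroup′ = solve-∀

-- The sumset contains the translate of `C` by one fixed a + b.
length-sumset3-≥ : ∀ A B C → 0 < length A → 0 < length B → Unique C → length C ≤ length (sumset3Set A B C)
length-sumset3-≥ A@(a ∷ _) B@(b ∷ _) C _ _ C! = begin
  length C ≡⟨ length-map (a + b +_) C ⟨
  length (map (a + b +_) C) ≤⟨ Unique⇒length≤ (Unique.map⁺ (+-cancelˡ-≡ (a + b) _ _) C!) sub ⟩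
  length (sumset3Set A B C) ∎
  where
  open ≤-Reasoning
  sub : ∀ {z} → z ∈ map (a + b +_) C → z ∈ sumset3Set A B C
  sub z∈ with c , c∈C , refl ← ∈-map⁻ (a + b +_) z∈ =
    ∈-deduplicate⁺ _≟_ {xs = sumset3 A B C}
      (∈-cartesianProductWith⁺ _+_ (∈-cartesianProductWith⁺ _+_ {A} {B} (here refl) (here refl)) c∈C)

All-sumset3 : ∀ {P : ℕ → Set} A B C → (∀ {a b c} → a ∈ A → b ∈ B → c ∈ C → P (c + b + a)) →
  All P (sumset3Set A B C)
All-sumset3 {P} A B C P[c+b+a] = All.tabulate λ {z} z∈ → elem (∈-deduplicate⁻ _≟_ (sumset3 A B C) z∈)
  where
  reverse : ∀ a b c → c + b + a ≡ a + b + c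
  reverse = solve-∀
  elem : ∀ {z} → z ∈ sumset3 A B C → P z
  elem z∈ with ab , c , ab∈ , c∈ , refl ← ∈-cartesianProductWith⁻ _+_ (cartesianProductWith _+_ A B) C z∈
          with a , b , a∈ , b∈ , refl ← ∈-cartesianProductWith⁻ _+_ A B ab∈ =
    subst P (reverse a b c) (P[c+b+a] a∈ b∈ c∈)

SubsetUpTo-mono : ∀ {m n S} → m ≤ n → SubsetUpTo m S → SubsetUpTo n S
SubsetUpTo-mono m≤n (S! , S≤m) = S! , All.map (λ (1≤s , s≤m) → 1≤s , ≤-trans s≤m m≤n) S≤m

-- The reciprocal of the density left after k₁ and then k₂ shifts of a set of density 1 / D
-- in an interval c times as long as the window of starting points.
loss : ℕ → ℕ → ℕ → ℕ → ℕ
loss c k₁ k₂ D = (2 * 1 * (2 * (2 * c * D) ^ k₁)) ^ k₂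

-- Isolates the dependence on `D`, which will be ⌊log₂ x⌋ and thus yields the power of the
-- logarithm.
loss≡ : ∀ c k₁ k₂ D → loss c k₁ k₂ D ≡ loss c k₁ k₂ 1 * D ^ (k₁ * k₂)
loss≡ c k₁ k₂ D = begin
  (2 * 1 * (2 * (2 * c * D) ^ k₁)) ^ k₂ ≡⟨ cong (λ u → (2 * 1 * (2 * u ^ k₁)) ^ k₂) (regroup c D) ⟩
  (2 * 1 * (2 * (2 * c * 1 * D) ^ k₁)) ^ k₂ ≡⟨ cong (λ u → (2 * 1 * (2 * u)) ^ k₂) (^-distribʳ-* k₁ (2 * c * 1) D) ⟩
  (2 * 1 * (2 * ((2 * c * 1) ^ k₁ * D ^ k₁))) ^ k₂ ≡⟨ cong (_^ k₂) (regroup′ ((2 * c * 1) ^ k₁) (D ^ k₁)) ⟩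
  (2 * 1 * (2 * (2 * c * 1) ^ k₁) * D ^ k₁) ^ k₂ ≡⟨ ^-distribʳ-* k₂ (2 * 1 * (2 * (2 * c * 1) ^ k₁)) (D ^ k₁) ⟩
  loss c k₁ k₂ 1 * (D ^ k₁) ^ k₂ ≡⟨ cong (loss c k₁ k₂ 1 *_) (^-*-assoc D k₁ k₂) ⟩
  loss c k₁ k₂ 1 * D ^ (k₁ * k₂) ∎
  where
  open ≡-Reasoning
  regroup : ∀ c d → 2 * c * d ≡ 2 * c * 1 * d
  regroup = solve-∀
  regroup′ : ∀ u v → 2 * 1 * (2 * (u * v)) ≡ 2 * 1 * (2 * u) * v
  regroup′ = solve-∀

module _ {S : List ℕ} {h c D k₁ k₂ : ℕ}
  .{{_ : NonZero h}} .{{_ : NonZero c}} .{{_ : NonZero D}} .{{_ : NonZero k₁}} .{{_ : NonZero k₂}}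
  (S! : Unique S) (S-bounds : ∀ {s} → s ∈ S → 2 * h < s × s ≤ c * (2 * h))
  (S-dense : 2 * h ≤ D * length S) (k₁≤k₂ : k₁ ≤ k₂)
  -- Since `D` and `E` are at most the total loss, this one inequality guarantees enough elements at
  -- every stage: in `S`, in the intermediate set and in `C`.
  (large : (k₂ + k₂) * loss c k₁ k₂ D ≤ h)
  where

  private
    open ≤-Reasoning

    E = (2 * c * D) ^ k₁
    W = loss c k₁ k₂ D

    instance
      n≢0 : NonZero (2 * h)
      n≢0 = m*n≢0 2 h
      base≢0 : NonZero (2 * c * D)
      base≢0 = m*n≢0 (2 * c) D {{m*n≢0 2 c}}
      loss-base≢0 : NonZero (2 * E)
      loss-base≢0 = m*n≢0 2 E {{_}} {{m^n≢0 (2 * c * D) k₁}}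

    E≤W : E ≤ W
    E≤W = begin
      E ≤⟨ m≤n*m E 2 ⟩
      2 * E ≤⟨ m≤n*m (2 * E) (2 * 1) ⟩
      2 * 1 * (2 * E) ≤⟨ m≤m^n (2 * 1 * (2 * E)) k₂ {{m*n≢0 (2 * 1) (2 * E)}} ⟩
      W ∎

    D≤W : D ≤ W
    D≤W = begin
      D ≤⟨ m≤n*m D (2 * c) {{m*n≢0 2 c}} ⟩
      2 * c * D ≤⟨ m≤m^n (2 * c * D) k₁ ⟩
      E ≤⟨ E≤W ⟩
      W ∎

    length-S : k₁ + k₁ ≤ length S
    length-S = *-cancelˡ-≤ D (begin
      D * (k₁ + k₁) ≤⟨ *-mono-≤ D≤W (+-mono-≤ k₁≤k₂ k₁≤k₂) ⟩
      W * (k₂ + k₂) ≡⟨ *-comm W (k₂ + k₂) ⟩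
      (k₂ + k₂) * W ≤⟨ large ⟩
      h ≤⟨ m≤n*m h 2 ⟩
      2 * h ≤⟨ S-dense ⟩
      D * length S ∎)

    length-interval : ∀ a → length (interval a h) ≡ h
    length-interval a = length-applyUpTo _ h

    interval-nonempty : ∀ a → 0 < length (interval a h)
    interval-nonempty a = subst (0 <_) (sym (length-interval a)) (>-nonZero⁻¹ h)

    upper-half≤2h : ∀ {t} → t ∈ interval h h → t ≤ 2 * h
    upper-half≤2h t∈ = ≤-trans (proj₂ (∈-interval⁻ {h} {h} t∈)) (≤-reflexive (cong (h +_) (sym (+-identityʳ h))))

    -- The first round leaves h / E elements in (h, 2h]. Relative to their upper bound 2h the
    -- density is 1 / (2E), whence the inner factor 2 in `loss`.
    first-density : ∀ t → length (interval h h) * length S ^ k₁ ≤ t * (2 * (c * (2 * h))) ^ k₁ →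
      2 * h ≤ 2 * E * t
    first-density t T-large = begin
      2 * h ≤⟨ *-monoʳ-≤ 2 (density-after-shifts {h} {t = t} c D k₁ S-dense
                 (subst (λ m → m * length S ^ k₁ ≤ t * (2 * (c * (2 * h))) ^ k₁) (length-interval h) T-large)) ⟩
      2 * (t * E) ≡⟨ regroup t E ⟩
      2 * E * t ∎
      where
      regroup : ∀ t d → 2 * (t * d) ≡ 2 * d * t
      regroup = solve-∀

    first-size : ∀ {t} → 2 * h ≤ 2 * E * t → k₂ + k₂ ≤ t
    first-size {t} T-dense = *-cancelˡ-≤ (2 * E) (begin
      2 * E * (k₂ + k₂) ≡⟨ regroup E (k₂ + k₂) ⟩
      2 * ((k₂ + k₂) * E) ≤⟨ *-monoʳ-≤ 2 (≤-trans (*-monoʳ-≤ (k₂ + k₂) E≤W) large) ⟩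
      2 * h ≤⟨ T-dense ⟩
      2 * E * t ∎)
      where
      regroup : ∀ d k → 2 * d * k ≡ 2 * (k * d)
      regroup = solve-∀

    -- Here the length ratio is 1, because the target set of the second round is bounded by `2 * h`
    -- itself.
    second-density : ∀ {t} u → 2 * h ≤ 2 * E * t →
      length (interval 0 h) * t ^ k₂ ≤ u * (2 * (2 * h)) ^ k₂ → h ≤ u * W
    second-density {t} u T-dense C-large = density-after-shifts {h} {t = u} 1 (2 * E) k₂ T-dense
      (subst₂ (λ m m′ → m * t ^ k₂ ≤ u * (2 * m′) ^ k₂) (length-interval 0) (sym (*-identityˡ (2 * h))) C-large)

    second-size : ∀ {u} → h ≤ u * W → k₂ ≤ u
    second-size C-dense = *-cancelʳ-≤ _ _ W {{>-nonZero (≤-trans (>-nonZero⁻¹ D) D≤W)}}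
      (≤-trans (*-monoˡ-≤ W (m≤m+n k₂ k₂)) (≤-trans large C-dense))

  -- The first round starts from (h, 2h], which lies below `S`. The surviving T therefore lies above
  -- (0, h], where the second round starts, so positive shifts suffice both times.
  two-shifts : ∃[ A ] ∃[ B ] ∃[ C ]
    ( SubsetUpTo (c * (2 * h)) A × SubsetUpTo (2 * h) B × SubsetUpTo h C
    × length A ≡ k₁ × length B ≡ k₂ × k₂ ≤ length C
    × (∀ {a b c} → a ∈ A → b ∈ B → c ∈ C → c + b + a ∈ S)
    × h ≤ length C * loss c k₁ k₂ D)
  two-shifts =
    let
      A , T , A⊆ , ∣A∣≡k₁ , T! , T⊆ , T+A⊆S , T-large =
        many-shifts S S! (λ s∈ → proj₂ (S-bounds s∈)) (interval! h h)
          (λ t∈ s∈ → ≤-<-trans (upper-half≤2h t∈) (proj₁ (S-bounds s∈)))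
          (interval-nonempty h) k₁ length-S
      T-dense = first-density (length T) T-large
      B , C , B⊆ , ∣B∣≡k₂ , C! , C⊆ , C+B⊆T , C-large =
        many-shifts T T! (λ t∈ → upper-half≤2h (T⊆ t∈)) (interval! 0 h)
          (λ c∈ t∈ → ≤-<-trans (proj₂ (∈-interval⁻ {0} {h} c∈)) (proj₁ (∈-interval⁻ {h} {h} (T⊆ t∈))))
          (interval-nonempty 0) k₂ (first-size T-dense)
      C-dense = second-density (length C) T-dense C-large
    in
      A , B , C , A⊆ , B⊆ , (C! , All.tabulate λ c∈ → ∈-interval⁻ {0} {h} (C⊆ c∈))
      , ∣A∣≡k₁ , ∣B∣≡k₂ , second-size C-dense , (λ a∈ b∈ c∈ → T+A⊆S a∈ (C+B⊆T b∈ c∈)) , C-dense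

-- The constant is represented by `p / q`. As ⌊log₂ x⌋ ≤ log x / log 2, passing to the natural
-- logarithm only multiplies it by (log 2) ^ (κ₁ κ₂).
theorem2 : (κ₁ κ₂ : ℕ) → 1 < κ₁ → κ₁ < κ₂ →
    ∃[ p ] ∃[ q ] (1 ≤ p × 1 ≤ q × ∃[ x₀ ] ((x : ℕ) → x₀ ≤ x →
    ∃[ A ] ∃[ B ] ∃[ C ] (SubsetUpTo x A × SubsetUpTo x B × SubsetUpTo x C
    × length A ≡ κ₁ × length B ≡ κ₂
    × length C ≥ length B × length B ≥ length A
    × All Prime (sumset3Set A B C)
    × p * x < q * length (sumset3Set A B C) * ⌊log₂ x ⌋ ^ (κ₁ * κ₂))))
-- The 128 comes from x < 2 ^ (7 + i) = 128 h. The threshold ensures ⌊log₂ x⌋ ≥ 6 + `L₀`.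
theorem2 κ₁ κ₂ 1<κ₁ κ₁<κ₂ = 1 , 128 * scale , s≤s z≤n , q≥1 , 2 ^ (6 + L₀) , construct
  where
  instance
    κ₁≢0 : NonZero κ₁
    κ₁≢0 = >-nonZero (≤-<-trans z≤n 1<κ₁)
    κ₂≢0 : NonZero κ₂
    κ₂≢0 = >-nonZero (≤-<-trans z≤n κ₁<κ₂)
  open ≤-Reasoning

  scale = loss 32 κ₁ κ₂ 1

  q≥1 : 1 ≤ 128 * scale
  q≥1 = ≤-trans (m^n>0 _ {{m*n≢0 (2 * 1) _ {{_}} {{m*n≢0 2 _ {{_}} {{m^n≢0 64 κ₁}}}}}} κ₂) (m≤n*m scale 128)

  -- The factor 64 = 2 ^ 6 pays for the step from 2 ^ (6 + i) down to h = 2 ^ i.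
  growth = polynomial≤2^ (64 * ((κ₂ + κ₂) * scale)) (κ₁ * κ₂)
  L₀ = proj₁ growth

  large : ∀ i → L₀ ≤ 6 + i → (κ₂ + κ₂) * loss 32 κ₁ κ₂ (6 + i) ≤ 2 ^ i
  large i L₀≤L = *-cancelˡ-≤ 64 (begin
    64 * ((κ₂ + κ₂) * loss 32 κ₁ κ₂ L) ≡⟨ cong (λ u → 64 * ((κ₂ + κ₂) * u)) (loss≡ 32 κ₁ κ₂ L) ⟩
    64 * ((κ₂ + κ₂) * (scale * L ^ (κ₁ * κ₂))) ≡⟨ regroup 64 (κ₂ + κ₂) scale (L ^ (κ₁ * κ₂)) ⟩
    64 * ((κ₂ + κ₂) * scale) * L ^ (κ₁ * κ₂) ≤⟨ proj₂ growth L L₀≤L ⟩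
    2 ^ L ≡⟨ ^-distribˡ-+-* 2 6 i ⟩
    64 * 2 ^ i ∎)
    where
    L = 6 + i
    regroup : ∀ e k s l → e * (k * (s * l)) ≡ e * (k * s) * l
    regroup = solve-∀

  construct : ∀ x → 2 ^ (6 + L₀) ≤ x →
    ∃[ A ] ∃[ B ] ∃[ C ] (SubsetUpTo x A × SubsetUpTo x B × SubsetUpTo x C
    × length A ≡ κ₁ × length B ≡ κ₂
    × length C ≥ length B × length B ≥ length A
    × All Prime (sumset3Set A B C)
    × 1 * x < 128 * scale * length (sumset3Set A B C) * ⌊log₂ x ⌋ ^ (κ₁ * κ₂))
  construct x 2^≤x =
    let A , B , C , A⊆ , B⊆ , C⊆ , ∣A∣ , ∣B∣ , κ₂≤C , sums∈S , C-dense =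
          two-shifts {S = primes n (31 * n)} {c = 32} {D = 6 + i} (primes! n (31 * n)) (λ p∈ → proj₂ (∈-primes⁻ {n} {31 * n} p∈))
          (primes-in-window (suc i)) (<⇒≤ κ₁<κ₂) (large i L₀≤6+i)
    in A , B , C
      , SubsetUpTo-mono 32n≤x A⊆ , SubsetUpTo-mono n≤x B⊆ , SubsetUpTo-mono h≤x C⊆
      , ∣A∣ , ∣B∣ , subst (_≤ length C) (sym ∣B∣) κ₂≤C , subst₂ _≤_ (sym ∣A∣) (sym ∣B∣) (<⇒≤ κ₁<κ₂)
      , All-sumset3 A B C (λ a∈ b∈ c∈ → proj₁ (∈-primes⁻ {n} {31 * n} (sums∈S a∈ b∈ c∈)))
      , many-sums (length C) (length (sumset3Set A B C)) C-dense (length-sumset3-≥ A B C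
                 (subst (0 <_) (sym ∣A∣) (≤-<-trans z≤n 1<κ₁))
                 (subst (0 <_) (sym ∣B∣) (≤-<-trans z≤n κ₁<κ₂)) (proj₁ C⊆))
    where
    -- The subtraction is exact. It makes 32n = 64h = 2 ^ ⌊log₂ x⌋ ≤ x, and the window of primes at
    -- n = 2 ^ (i + 1) has reciprocal density 5 + (i + 1) = ⌊log₂ x⌋.
    i = ⌊log₂ x ⌋ ∸ 6
    h = 2 ^ i
    n = 2 * h
    instance
      h≢0 : NonZero h
      h≢0 = m^n≢0 2 i
    6+L₀≤log : 6 + L₀ ≤ ⌊log₂ x ⌋
    6+L₀≤log = subst (_≤ ⌊log₂ x ⌋) (⌊log₂[2^n]⌋≡n (6 + L₀)) (⌊log₂⌋-mono-≤ 2^≤x)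
    L≡ : 6 + i ≡ ⌊log₂ x ⌋
    L≡ = m+[n∸m]≡n (≤-trans (m≤m+n 6 L₀) 6+L₀≤log)
    L₀≤6+i : L₀ ≤ 6 + i
    L₀≤6+i = subst (L₀ ≤_) (sym L≡) (≤-trans (m≤n+m L₀ 6) 6+L₀≤log)
    32n≤x : 32 * n ≤ x
    32n≤x = begin
      32 * 2 ^ suc i ≡⟨ ^-distribˡ-+-* 2 5 (suc i) ⟨
      2 ^ (6 + i) ≡⟨ cong (2 ^_) L≡ ⟩
      2 ^ ⌊log₂ x ⌋ ≤⟨ 2^⌊log₂n⌋≤n x (≤-trans (m^n>0 2 (6 + L₀)) 2^≤x) ⟩
      x ∎
    n≤x : n ≤ x
    n≤x = ≤-trans (m≤n*m n 32) 32n≤x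
    h≤x : h ≤ x
    h≤x = ≤-trans (m≤n*m h 2) n≤x
    many-sums : ∀ u v → h ≤ u * loss 32 κ₁ κ₂ (6 + i) → u ≤ v →
      1 * x < 128 * scale * v * ⌊log₂ x ⌋ ^ (κ₁ * κ₂)
    many-sums u v C-dense u≤v = begin-strict
      1 * x ≡⟨ *-identityˡ x ⟩
      x <⟨ n<2^[1+⌊log₂n⌋] x ⟩
      2 ^ suc ⌊log₂ x ⌋ ≡⟨ cong (λ l → 2 ^ suc l) L≡ ⟨
      2 ^ (7 + i) ≡⟨ ^-distribˡ-+-* 2 7 i ⟩
      128 * h ≤⟨ *-monoʳ-≤ 128 (≤-trans C-dense (*-monoˡ-≤ (loss 32 κ₁ κ₂ (6 + i)) u≤v)) ⟩
      128 * (v * loss 32 κ₁ κ₂ (6 + i)) ≡⟨ cong (λ u → 128 * (v * u)) (loss≡ 32 κ₁ κ₂ (6 + i)) ⟩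
      128 * (v * (scale * (6 + i) ^ (κ₁ * κ₂))) ≡⟨ regroup 128 v scale ((6 + i) ^ (κ₁ * κ₂)) ⟩
      128 * scale * v * (6 + i) ^ (κ₁ * κ₂) ≡⟨ cong (λ l → 128 * scale * v * l ^ (κ₁ * κ₂)) L≡ ⟩
      128 * scale * v * ⌊log₂ x ⌋ ^ (κ₁ * κ₂) ∎
      where
      regroup : ∀ e c s l → e * (c * (s * l)) ≡ e * s * c * l
      regroup = solve-∀
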